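{- Let $q$ and $n$ be positive integers and let $p=2q$. The number of pairs $(P_1,P_2)$ of planar partitions of $[qn]$ such that $P_1$ is a refinement of $P_2$ and $P_1$ is a $q$-partition (every block of $P_1$ has exactly $q$ elements), with $P_2$ an arbitrary planar partition, equals the Fuss-Catalan number $A_n^{p}=\frac{1}{pn+1}\binom{pn+1}{n}$.
   Context: For a positive integer $N$, $[N]=\{1,\dots,N\}$. A set partition of $[N]$ is planar (non-crossing) if there do not exist $a<b<c<d$ in $[N]$ with $a,c$ in one block and $b,d$ in a different block. A partition $P_1$ is a refinement of $P_2$ if every block of $P_1$ is contained in some block of $P_2$. A $q$-partition of $[qn]$ is a set partition of $[qn]$ all of whose blocks have exactly $q$ elements. -}

module Defs where

open import Data.Nat using (ℕ; zero; suc; _+_; _<_)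
open import Data.Bool using (Bool; true; false)
open import Data.Fin using (Fin; toℕ)
open import Data.Vec using (Vec; lookup)
open import Data.Product using (_×_; ∃-syntax)
open import Relation.Binary.PropositionalEquality using (_≡_)
open import Relation.Nullary using (¬_)

-- A binary relation on [N] = Fin N (element i ↦ number toℕ i + 1),
-- stored as an N×N Boolean matrix so that it is finite data with
-- decidable equality (distinct matrices = distinct relations).
Rel[_] : ℕ → Set
Rel[ N ] = Vec (Vec Bool N) N

_∋_~_ : ∀ {N} → Rel[ N ] → Fin N → Fin N → Set
R ∋ i ~ j = lookup (lookup R i) j ≡ true

-- A set partition of [N], encoded as its "same block" equivalence relation.
record IsSetPartition {N : ℕ} (R : Rel[ N ]) : Set where
  field
    refl~  : ∀ i → R ∋ i ~ i
    sym~   : ∀ i j → R ∋ i ~ j → R ∋ j ~ i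
    trans~ : ∀ i j k → R ∋ i ~ j → R ∋ j ~ k → R ∋ i ~ k

_<ᶠ_ : ∀ {N} → Fin N → Fin N → Set
a <ᶠ b = toℕ a < toℕ b

IsPlanar : ∀ {N} → Rel[ N ] → Set
IsPlanar {N} R =
  ¬ (∃[ a ] ∃[ b ] ∃[ c ] ∃[ d ]
       (a <ᶠ b × b <ᶠ c × c <ᶠ d ×
        R ∋ a ~ c × R ∋ b ~ d × ¬ (R ∋ a ~ b)))

IsPlanarPartition : ∀ {N} → Rel[ N ] → Set
IsPlanarPartition R = IsSetPartition R × IsPlanar R

Refines : ∀ {N} → Rel[ N ] → Rel[ N ] → Set
Refines {N} R₁ R₂ = ∀ (i j : Fin N) → R₁ ∋ i ~ j → R₂ ∋ i ~ j

countTrue : ∀ {k} → Vec Bool k → ℕ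
countTrue Vec.[] = 0
countTrue (true Vec.∷ v) = suc (countTrue v)
countTrue (false Vec.∷ v) = countTrue v

blockSize : ∀ {N} → Rel[ N ] → Fin N → ℕ
blockSize R i = countTrue (lookup R i)

IsQPartition : ∀ {N} → ℕ → Rel[ N ] → Set
IsQPartition {N} q R = IsSetPartition R × (∀ (i : Fin N) → blockSize R i ≡ q)

{-# OPTIONS --safe #-}
module Submission where

-- Name each block by its minimum and read the elements from left to right,
-- keeping a stack of the blocks of P₂ that are still visible and of the blocks
-- of P₁ that are still incomplete.  The next element either opens a new block of
-- P₂, or, after some topmost blocks of P₂ are closed, opens a new block of P₁ in
-- the top block of P₂ or continues the incomplete block of P₁ on top.  Labellings
-- of [qn] produced by this automaton are exactly the pairs (P₁, P₂).  If
-- G = 1 + z G^(2q), the completions of a stack are counted by a power of G whose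
-- exponent gains 2q − 1 when a block of P₁ is opened and loses 1 at every
-- choice declined, and the coefficients of G^h are given by Raney's formula
-- h / (pm + h) · binomial (pm + h, m), with p = 2q.

open import Defs
open import Data.Bool using (Bool; true; false; if_then_else_)
open import Data.Empty using (⊥-elim)
open import Data.Fin using (Fin; zero; suc; toℕ; fromℕ<)
open import Data.Fin.Properties using (toℕ<n; toℕ-fromℕ<; toℕ-injective)
open import Data.List using (List; []; _∷_; length; map; concatMap)
open import Data.List.Membership.Propositional using (_∈_; find; lose)
open import Data.List.Membership.Propositional.Properties using (∈-map⁺; ∈-map⁻; ∈-concatMap⁺; ∈-concatMap⁻)
open import Data.List.Properties using (length-++; length-map)
import Data.List.Relation.Unary.All as All
import Data.List.Relation.Unary.All.Properties as All
open import Data.List.Relation.Unary.AllPairs using (AllPairs; []; _∷_)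
import Data.List.Relation.Unary.AllPairs as AllPairs
import Data.List.Relation.Unary.AllPairs.Properties as AllPairs
open import Data.List.Relation.Unary.All using ([]; _∷_)
open import Data.List.Relation.Unary.Any using (here; there)
open import Data.List.Relation.Unary.Unique.Propositional using (Unique)
import Data.List.Relation.Unary.Unique.Propositional.Properties as Unique
open import Data.Nat using (ℕ; zero; suc; _+_; _*_; _/_; _≤_; _<_; z≤n; s≤s)
open import Data.Nat.Combinatorics using (_C_; nCk+nC[k+1]≡[n+1]C[k+1]; nC1≡n)
open import Data.Nat.DivMod using (m*n/n≡m)
open import Data.Nat.Properties
open import Data.Nat.Solver using (module +-*-Solver)
open import Data.Product using (Σ; ∃-syntax; _×_; _,_; proj₁; proj₂) renaming (map₂ to map-proof)
open import Data.Sum using (_⊎_; inj₁; inj₂; map₂)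
open import Data.Vec using (Vec; []; _∷_; lookup; tabulate)
open import Data.Vec.Properties using (∷-injective; lookup∘tabulate; tabulate∘lookup; tabulate-cong)
open import Function using (_∘_; _on_; case_of_)
open import Function.Bundles using (_⇔_; mk⇔)
open import Relation.Binary using (tri<; tri≈; tri>)
open import Relation.Binary.PropositionalEquality using (_≡_; _≢_; refl; sym; trans; cong; cong₂; subst; subst₂; module ≡-Reasoning)
open import Relation.Nullary using (¬_; Dec; yes; no; does; contradiction)
open import Relation.Nullary.Decidable using (dec-true; dec-false)
open import Algebra.Properties.CommutativeSemigroup +-commutativeSemigroup using (x∙yz≈y∙xz)
open +-*-Solver using (solve; _:=_; _:+_; _:*_; con)

-- Binomial identities and Raney numbers.

-- The absorption identity (k + 1) C(n, k + 1) = (n - k) C(n, k), with the subtraction moved to the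
-- other side.
binomial-ratio : ∀ n k → suc k * (n C suc k) + k * (n C k) ≡ n * (n C k)
binomial-ratio zero zero = refl
binomial-ratio zero (suc k) rewrite *-zeroʳ k = refl
binomial-ratio (suc n) zero rewrite nC1≡n (suc n) =
  solve 1 (λ n → (con 1 :+ n :+ con 0) :+ con 0 := (con 1 :+ n) :* con 1) refl n
binomial-ratio (suc n) (suc k)
  rewrite sym (nCk+nC[k+1]≡[n+1]C[k+1] n (suc k)) | sym (nCk+nC[k+1]≡[n+1]C[k+1] n k) = begin
    suc (suc k) * (B + D) + suc k * (A + B)
      ≡⟨ solve 4 (λ k A B D →
           (con 2 :+ k) :* (B :+ D) :+ (con 1 :+ k) :* (A :+ B)
           := ((con 2 :+ k) :* D :+ (con 1 :+ k) :* B) :+ ((con 1 :+ k) :* B :+ k :* A) :+ A :+ B)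
           refl k A B D ⟩
    (suc (suc k) * D + suc k * B) + (suc k * B + k * A) + A + B
      ≡⟨ cong₂ (λ u v → u + v + A + B) (binomial-ratio n (suc k)) (binomial-ratio n k) ⟩
    n * B + n * A + A + B
      ≡⟨ solve 3 (λ n A B → n :* B :+ n :* A :+ A :+ B := (con 1 :+ n) :* (A :+ B)) refl n A B ⟩
    suc n * (A + B) ∎
  where
  open ≡-Reasoning
  A = n C k
  B = n C suc k
  D = n C suc (suc k)

-- raney p h m is the coefficient of zᵐ in G(z)ʰ, where G = 1 + z Gᵖ.
raney : ℕ → ℕ → ℕ → ℕ
raney p zero    zero    = 1
raney p zero    (suc m) = 0
raney p (suc h) zero    = raney p h zero
raney p (suc h) (suc m) = raney p h (suc m) + raney p (h + p) m

raney-zero : ∀ p h → raney p h 0 ≡ 1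
raney-zero p zero    = refl
raney-zero p (suc h) = raney-zero p h

-- Multiplying by T makes the two summands of the recursion share the row T
-- of Pascal's triangle.
raney-binomial : ∀ t h m → let p = suc t in
  raney p h m * (p * m + h) ≡ h * ((p * m + h) C m)
raney-binomial t zero zero = trans (+-identityʳ _) (trans (+-identityʳ _) (*-zeroʳ t))
raney-binomial t zero (suc m) = refl
raney-binomial t (suc h) zero
  rewrite raney-zero (suc t) h | *-zeroʳ t = cong suc (solve 1 (λ h → h :+ con 0 := h :* con 1) refl h)
raney-binomial t (suc h) (suc m) = *-cancelˡ-≡ _ _ T (begin
  T * ((a + b) * (p * suc m + suc h))
    ≡⟨ cong (λ u → T * ((a + b) * u)) (+-suc (p * suc m) h) ⟩
  T * ((a + b) * suc T)
    ≡⟨ solve 3 (λ T a b → T :* ((a :+ b) :* (con 1 :+ T)) := (con 1 :+ T) :* (a :* T :+ b :* T)) refl T a b ⟩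
  suc T * (a * T + b * T)
    ≡⟨ cong₂ (λ u v → suc T * (u + v)) (raney-binomial t h (suc m))
         (trans (cong (b *_) (sym T′≡T)) (trans (raney-binomial t (h + p) m) (cong (λ u → (h + p) * (u C m)) T′≡T))) ⟩
  suc T * (h * Y + (h + p) * X)
    -- Adding `p * (m * X)` to both sides lets `binomial-ratio` rewrite `T * X` without subtraction.
    ≡⟨ +-cancelʳ-≡ (p * (m * X)) _ _ pascal ⟩
  T * (suc h * (X + Y))
    ≡⟨ cong (λ u → T * (suc h * u)) (nCk+nC[k+1]≡[n+1]C[k+1] T m) ⟩
  T * (suc h * (suc T C suc m))
    ≡⟨ cong (λ u → T * (suc h * (u C suc m))) (sym (+-suc (p * suc m) h)) ⟩
  T * (suc h * ((p * suc m + suc h) C suc m)) ∎)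
  where
  open ≡-Reasoning
  p = suc t
  T = p * suc m + h
  X = T C m
  Y = T C suc m
  a = raney p h (suc m)
  b = raney p (h + p) m
  T′≡T : p * m + (h + p) ≡ T
  T′≡T = solve 3 (λ p m h → p :* m :+ (h :+ p) := p :* (con 1 :+ m) :+ h) refl p m h
  pascal : suc T * (h * Y + (h + p) * X) + p * (m * X) ≡ T * (suc h * (X + Y)) + p * (m * X)
  pascal = begin
    suc T * (h * Y + (h + p) * X) + p * (m * X)
      ≡⟨ solve 5 (λ p m h X Y → let T = p :* (con 1 :+ m) :+ h in
           (con 1 :+ T) :* (h :* Y :+ (h :+ p) :* X) :+ p :* (m :* X)
           := T :* h :* Y :+ h :* Y :+ T :* (h :+ con 1) :* X :+ p :* (T :* X))
           refl p m h X Y ⟩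
    T * h * Y + h * Y + T * (h + 1) * X + p * (T * X)
      ≡⟨ cong (λ u → T * h * Y + h * Y + T * (h + 1) * X + p * u) (sym (binomial-ratio T m)) ⟩
    T * h * Y + h * Y + T * (h + 1) * X + p * (suc m * Y + m * X)
      ≡⟨ solve 5 (λ p m h X Y → let T = p :* (con 1 :+ m) :+ h in
           T :* h :* Y :+ h :* Y :+ T :* (h :+ con 1) :* X :+ p :* ((con 1 :+ m) :* Y :+ m :* X)
           := T :* ((con 1 :+ h) :* (X :+ Y)) :+ p :* (m :* X))
           refl p m h X Y ⟩
    T * (suc h * (X + Y)) + p * (m * X) ∎

-- Stacks of open blocks.

-- paused b is an open block b of P₂; gap r a b is a block a of P₁ inside the
-- block b of P₂ that still lacks r + 1 elements.
data Frame : Set where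
  paused : (b : ℕ) → Frame
  gap    : (r a b : ℕ) → Frame

Stack : Set
Stack = List Frame

-- Here `r` is the exact number of missing elements, one more than the `gap` records; a completed
-- block leaves no frame.
push : ℕ → ℕ → ℕ → Stack → Stack
push zero    a b s = s
push (suc r) a b s = gap r a b ∷ s

missing : Stack → ℕ
missing []               = 0
missing (paused b ∷ s)   = missing s
missing (gap r a b ∷ s) = suc r + missing s

missing-push : ∀ r {a b} s → missing (push r a b s) ≡ r + missing s
missing-push zero    s = refl
missing-push (suc r) s = refl

-- The completions of the stack s have generating function G^(1 + weight s):
-- one factor for each paused block and two for each missing element.
weight : Stack → ℕ
weight []              = 0
weight (paused b ∷ s)  = suc (weight s)
weight (gap r a b ∷ s) = suc r + suc r + weight s

weight-push : ∀ r {a b} s → weight (push r a b s) ≡ r + r + weight s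
weight-push zero    s = refl
weight-push (suc r) s = refl

-- Counting occurrences of a label.

indicator : ℕ → ℕ → ℕ
indicator x a = if does (x ≟ a) then 1 else 0

indicator-refl : ∀ a → indicator a a ≡ 1
indicator-refl a rewrite dec-true (a ≟ a) refl = refl

indicator-≢ : ∀ {x a} → x ≢ a → indicator x a ≡ 0
indicator-≢ {x} {a} x≢a rewrite dec-false (x ≟ a) x≢a = refl

count : (ℕ → ℕ) → ℕ → ℕ → ℕ
count f a zero    = 0
count f a (suc n) = indicator (f n) a + count f a n

count-mono : ∀ f a {m n} → m ≤ n → count f a m ≤ count f a n
count-mono f a {n = zero}  z≤n = z≤n
count-mono f a {m} {suc n} m≤1+n with m ≤? n
... | yes m≤n = ≤-trans (count-mono f a m≤n) (m≤n+m _ (indicator (f n) a))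
... | no  m≰n rewrite ≤-antisym m≤1+n (≰⇒> m≰n) = ≤-refl

count-find : ∀ f a i n → count f a i < count f a n → ∃[ d ] (i ≤ d × d < n × f d ≡ a)
count-find f a i zero    ()
count-find f a i (suc n) lt with i ≤? n | f n ≟ a
... | no  i≰n | _        = contradiction (<-≤-trans lt (count-mono f a (≰⇒> i≰n))) (<-irrefl refl)
... | yes i≤n | yes fn≡a = n , i≤n , n<1+n n , fn≡a
... | yes i≤n | no  fn≢a with count-find f a i n (subst (λ u → count f a i < u + count f a n) (indicator-≢ fn≢a) lt)
...   | d , i≤d , d<n , fd≡a = d , i≤d , m<n⇒m<1+n d<n , fd≡a

count-fresh : ∀ f {a} n → (∀ {j} → j < n → f j ≢ a) → count f a n ≡ 0
count-fresh f zero    fresh = refl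
count-fresh f (suc n) fresh = cong₂ _+_ (indicator-≢ (fresh (n<1+n n))) (count-fresh f n (fresh ∘ m<n⇒m<1+n))

-- Block minima, crossings and visibility.

-- A partition is represented by the map sending each element to the minimum of its block.
Canonical : (ℕ → ℕ) → ℕ → Set
Canonical f n = ∀ {j} → j < n → f j ≤ j × f (f j) ≡ f j

NonCrossing : (ℕ → ℕ) → ℕ → Set
NonCrossing f n = ∀ {a b c d} → a < b → b < c → c < d → d < n → f a ≡ f c → f b ≡ f d → f a ≡ f b

-- The element n can be added to the block y without a crossing.
Visible : (ℕ → ℕ) → ℕ → ℕ → Set
Visible f n y = ∀ {a b c} → a < b → b < c → c < n → f b ≡ y → f a ≡ f c → f a ≡ y

canonical-suc : ∀ {f n} → Canonical f n → f n ≡ n ⊎ (f n < n × f (f n) ≡ f n) → Canonical f (suc n)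
canonical-suc {f} {n} can p {j} j<1+n with m<1+n⇒m<n∨m≡n j<1+n | p
... | inj₁ j<n  | _                  = can j<n
... | inj₂ refl | inj₁ fn≡n          = ≤-reflexive fn≡n , cong f fn≡n
... | inj₂ refl | inj₂ (fn<n , ffn)  = <⇒≤ fn<n , ffn

noncrossing-suc : ∀ {f n} → NonCrossing f n → Visible f n (f n) → NonCrossing f (suc n)
noncrossing-suc nc vis a<b b<c c<d d<1+n fa≡fc fb≡fd with m<1+n⇒m<n∨m≡n d<1+n
... | inj₁ d<n  = nc a<b b<c c<d d<n fa≡fc fb≡fd
... | inj₂ refl = trans (vis a<b b<c c<d fb≡fd fa≡fc) (sym fb≡fd)

noncrossing-visible : ∀ {f n i} → NonCrossing f n → i < n → Visible f i (f i)
noncrossing-visible nc i<n a<b b<c c<i fb≡fi fa≡fc = trans (nc a<b b<c c<i i<n fa≡fc fb≡fi) fb≡fi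

-- A label never exceeds its position, so no element before `n` carries the label `n`.
visible-fresh : ∀ {f n} → Canonical f n → Visible f n n
visible-fresh can a<b b<c c<n refl _ = contradiction (proj₁ (can (<-trans b<c c<n))) (<⇒≱ (<-trans b<c c<n))

visible-pred : ∀ {f n y} → Visible f (suc n) y → Visible f n y
visible-pred vis a<b b<c c<n = vis a<b b<c (m<n⇒m<1+n c<n)

visible-self : ∀ {f n} → Visible f n (f n) → Visible f (suc n) (f n)
visible-self vis a<b b<c c<1+n fb≡y fa≡fc with m<1+n⇒m<n∨m≡n c<1+n
... | inj₁ c<n  = vis a<b b<c c<n fb≡y fa≡fc
... | inj₂ refl = fa≡fc

-- Reading `n` could hide `z` only by an arc from some `a` to `n` over an element `b` of `z`. Then
-- `z < f n < b`, and the arc from `z` to `b` would already hide the block `f n` from `n`.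
visible-below : ∀ {f n z} → Canonical f (suc n) → Visible f n (f n) → Visible f n z → f z ≡ z → z < f n →
                Visible f (suc n) z
visible-below {f} {n} {z} can visₙ vis fz≡z z<fn {a} {b} a<b b<c c<1+n fb≡z fa≡fc with m<1+n⇒m<n∨m≡n c<1+n
... | inj₁ c<n  = vis a<b b<c c<n fb≡z fa≡fc
... | inj₂ refl = contradiction (trans (sym fz≡z) (visₙ z<fn fn<b b<c (proj₂ (can ≤-refl)) (trans fz≡z (sym fb≡z)))) (<⇒≢ z<fn)
  where
  fn<b : f n < b
  fn<b = ≤-<-trans (≤-trans (≤-reflexive (sym fa≡fc)) (proj₁ (can (<-trans a<b (m<n⇒m<1+n b<c))))) a<b

-- The arc from `f n` to `n` passes over `z`.
visible-above : ∀ {f n z} → Canonical f (suc n) → z < n → f z ≡ z → f n < z → ¬ Visible f (suc n) z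
visible-above can z<n fz≡z fn<z vis =
  <⇒≢ fn<z (trans (sym (proj₂ (can ≤-refl))) (vis fn<z z<n ≤-refl fz≡z (proj₂ (can ≤-refl))))

-- Elements still lacking in a block of P₁.

lacking : Stack → ℕ → ℕ
lacking []               x = 0
lacking (paused b ∷ s)   x = lacking s x
lacking (gap r a b ∷ s) x = suc r * indicator a x + lacking s x

lacking-push : ∀ r {a b} s x → lacking (push r a b s) x ≡ r * indicator a x + lacking s x
lacking-push zero    s x = refl
lacking-push (suc r) s x = refl

lacking-gap : ∀ {r a b s} → gap r a b ∈ s → 0 < lacking s a
lacking-gap {r} {a} (here refl) rewrite indicator-refl a = s≤s z≤n
lacking-gap {s = paused _ ∷ s} (there g∈) = lacking-gap g∈
lacking-gap {s = gap r a _ ∷ s} (there g∈) = ≤-trans (lacking-gap g∈) (m≤n+m _ (suc r * indicator a _))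

lacking⇒gap : ∀ {a} s → 0 < lacking s a → ∃[ r ] ∃[ b ] gap r a b ∈ s
lacking⇒gap (paused _ ∷ s) lt with lacking⇒gap s lt
... | r , b , g∈ = r , b , there g∈
lacking⇒gap {a} (gap r a′ b ∷ s) lt with a′ ≟ a
... | yes refl = r , b , here refl
... | no  a′≢a with lacking⇒gap s (subst (0 <_) (cong (_+ lacking s a) (trans (cong (suc r *_) (indicator-≢ a′≢a)) (*-zeroʳ r))) lt)
...   | r′ , b′ , g∈ = r′ , b′ , there g∈

no-gap⇒missing≡0 : ∀ s → (∀ {r a b} → ¬ gap r a b ∈ s) → missing s ≡ 0
no-gap⇒missing≡0 []              h = refl
no-gap⇒missing≡0 (paused _ ∷ s)  h = no-gap⇒missing≡0 s (h ∘ there)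
no-gap⇒missing≡0 (gap r a b ∷ s) h = contradiction (here refl) h

missing≡0⇒lacking≡0 : ∀ s → missing s ≡ 0 → ∀ a → lacking s a ≡ 0
missing≡0⇒lacking≡0 []             eq a = refl
missing≡0⇒lacking≡0 (paused _ ∷ s) eq a = missing≡0⇒lacking≡0 s eq a

-- Auxiliary facts on Booleans, vectors and lists.

does⇒ : ∀ {P : Set} (d : Dec P) → does d ≡ true → P
does⇒ (yes p) _ = p

bool-ext : ∀ {x y : Bool} → (x ≡ true → y ≡ true) → (y ≡ true → x ≡ true) → x ≡ y
bool-ext {true}  {y}     p q = sym (p refl)
bool-ext {false} {false} p q = refl
bool-ext {false} {true}  p q = q refl

vec-ext : ∀ {A : Set} {n} {v w : Vec A n} → (∀ i → lookup v i ≡ lookup w i) → v ≡ w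
vec-ext {v = v} {w} h = trans (sym (tabulate∘lookup v)) (trans (tabulate-cong h) (tabulate∘lookup w))

-- Injectivity is asked on members only: `partitions` forgets the labels, which can be recovered
-- when they are block minima.
unique-map-on : ∀ {A B : Set} {f : A → B} {xs} →
                (∀ {x y} → x ∈ xs → y ∈ xs → f x ≡ f y → x ≡ y) → Unique xs → Unique (map f xs)
unique-map-on inj []       = []
unique-map-on inj (x∉ ∷ u) =
  All.map⁺ (All.tabulate (λ y∈ eq → All.lookup x∉ y∈ (inj (here refl) (there y∈) eq)))
  ∷ unique-map-on (λ x∈ y∈ → inj (there x∈) (there y∈)) u

<⇒toℕ : ∀ {n j} → j < n → ∃[ i ] toℕ {n} i ≡ j
<⇒toℕ j<n = fromℕ< j<n , toℕ-fromℕ< j<n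

-- The automaton is analysed with functions on all of ℕ, so finite data are continued by a default
-- value; only arguments below `n` are constrained later.
extend : ∀ {A : Set} {n} → A → (Fin n → A) → ℕ → A
extend {n = zero}  d h j       = d
extend {n = suc n} d h zero    = h zero
extend {n = suc n} d h (suc j) = extend d (h ∘ suc) j

extend-toℕ : ∀ {A : Set} {n} d (h : Fin n → A) i → extend d h (toℕ i) ≡ h i
extend-toℕ d h zero    = refl
extend-toℕ d h (suc i) = extend-toℕ d (h ∘ suc) i

-- Label functions as Boolean matrices.

-- The column comes first in the test, so that row `i` lists the summands of
-- `count f (f (toℕ i)) n`.
matrix : ∀ n → (ℕ → ℕ) → Rel[ n ]
matrix n f = tabulate λ i → tabulate λ j → does (f (toℕ j) ≟ f (toℕ i))

module _ {n : ℕ} (f : ℕ → ℕ) where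

  lookup-matrix : ∀ i j → lookup (lookup (matrix n f) i) j ≡ does (f (toℕ j) ≟ f (toℕ i))
  lookup-matrix i j = trans (cong (λ v → lookup v j) (lookup∘tabulate _ i)) (lookup∘tabulate _ j)

  matrix⁺ : ∀ i j → f (toℕ i) ≡ f (toℕ j) → matrix n f ∋ i ~ j
  matrix⁺ i j eq = trans (lookup-matrix i j) (dec-true (f (toℕ j) ≟ f (toℕ i)) (sym eq))

  matrix⁻ : ∀ i j → matrix n f ∋ i ~ j → f (toℕ i) ≡ f (toℕ j)
  matrix⁻ i j p = sym (does⇒ (f (toℕ j) ≟ f (toℕ i)) (trans (sym (lookup-matrix i j)) p))

  matrix-partition : IsSetPartition (matrix n f)
  matrix-partition = record
    { refl~  = λ i → matrix⁺ i i refl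
    ; sym~   = λ i j p → matrix⁺ j i (sym (matrix⁻ i j p))
    ; trans~ = λ i j k p q → matrix⁺ i k (trans (matrix⁻ i j p) (matrix⁻ j k q)) }

  noncrossing⇒planar : NonCrossing f n → IsPlanar (matrix n f)
  noncrossing⇒planar nc (a , b , c , d , a<b , b<c , c<d , ac , bd , ¬ab) =
    ¬ab (matrix⁺ a b (nc a<b b<c c<d (toℕ<n d) (matrix⁻ a c ac) (matrix⁻ b d bd)))

  planar⇒noncrossing : IsPlanar (matrix n f) → NonCrossing f n
  planar⇒noncrossing pl {a} {b} a<b b<c c<d d<n fa≡fc fb≡fd
    with f a ≟ f b | <⇒toℕ (<-trans a<b (<-trans b<c (<-trans c<d d<n)))
       | <⇒toℕ (<-trans b<c (<-trans c<d d<n)) | <⇒toℕ (<-trans c<d d<n) | <⇒toℕ d<n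
  ... | yes eq | _ | _ | _ | _ = eq
  ... | no neq | a , refl | b , refl | c , refl | d , refl =
    contradiction (a , b , c , d , a<b , b<c , c<d , matrix⁺ a c fa≡fc , matrix⁺ b d fb≡fd , neq ∘ matrix⁻ a b) pl

refines⇒ : ∀ {n} f g → Refines (matrix n f) (matrix n g) →
           ∀ {i j} → i < n → j < n → f i ≡ f j → g i ≡ g j
refines⇒ f g ref i<n j<n eq with <⇒toℕ i<n | <⇒toℕ j<n
... | i , refl | j , refl = matrix⁻ g i j (ref i j (matrix⁺ f i j eq))

-- `f j` shares the block of `j` for `f`, hence also for `g`, and `g j` is the minimum of that
-- block.
canonical-≤ : ∀ {n} f g → Canonical f n → Canonical g n → matrix n f ≡ matrix n g → ∀ {j} → j < n → g j ≤ f j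
canonical-≤ {n} f g can₁ can₂ eq {j} j<n = ≤-trans
  (≤-reflexive (sym (refines⇒ f g (λ i k → subst (_∋ i ~ k) eq) fj<n j<n (proj₂ (can₁ j<n)))))
  (proj₁ (can₂ fj<n))
  where
  fj<n = ≤-<-trans (proj₁ (can₁ j<n)) j<n

canonical-unique : ∀ {n} f g → Canonical f n → Canonical g n → matrix n f ≡ matrix n g → ∀ {j} → j < n → f j ≡ g j
canonical-unique f g can₁ can₂ eq j<n =
  ≤-antisym (canonical-≤ g f can₂ can₁ (sym eq) j<n) (canonical-≤ f g can₁ can₂ eq j<n)

matrix-cong : ∀ {n} f g → (∀ i → f (toℕ i) ≡ g (toℕ i)) → matrix n f ≡ matrix n g
matrix-cong f g eq = tabulate-cong λ i → tabulate-cong λ j → cong₂ (λ x y → does (x ≟ y)) (eq j) (eq i)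

-- `count` peels its range from the top, `tabulate` from the bottom.
count-front : ∀ f a n → count f a (suc n) ≡ indicator (f 0) a + count (f ∘ suc) a n
count-front f a zero    = refl
count-front f a (suc n) = trans (cong (indicator (f (suc n)) a +_) (count-front f a n))
  (x∙yz≈y∙xz (indicator (f (suc n)) a) (indicator (f 0) a) (count (f ∘ suc) a n))

countTrue-∷ : ∀ {k} b (v : Vec Bool k) → countTrue (b ∷ v) ≡ (if b then 1 else 0) + countTrue v
countTrue-∷ true  v = refl
countTrue-∷ false v = refl

countTrue-tabulate : ∀ n f a → countTrue (tabulate {n = n} (λ j → does (f (toℕ j) ≟ a))) ≡ count f a n
countTrue-tabulate zero    f a = refl
countTrue-tabulate (suc n) f a = trans (countTrue-∷ (does (f 0 ≟ a)) _)
  (trans (cong (indicator (f 0) a +_) (countTrue-tabulate n (f ∘ suc) a)) (sym (count-front f a n)))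

blockSize-matrix : ∀ {n} f i → blockSize (matrix n f) i ≡ count f (f (toℕ i)) n
blockSize-matrix {n} f i = trans (cong countTrue (lookup∘tabulate _ i)) (countTrue-tabulate n f (f (toℕ i)))

-- Block minima of a given partition.

least : ∀ {k} (v : Vec Bool k) i → lookup v i ≡ true →
        ∃[ j ] (lookup v j ≡ true × (∀ l → lookup v l ≡ true → toℕ j ≤ toℕ l))
least (true ∷ v)  i       p = zero , refl , λ _ _ → z≤n
least (false ∷ v) (suc i) p with least v i p
... | j , q , min = suc j , q , λ { (suc l) e → s≤s (min l e) }

module Representatives {n : ℕ} {R : Rel[ n ]} (part : IsSetPartition R) where
  open IsSetPartition part

  rep : Fin n → Fin n
  rep i = proj₁ (least (lookup R i) i (refl~ i))

  rep-~ : ∀ i → R ∋ i ~ rep i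
  rep-~ i = proj₁ (proj₂ (least (lookup R i) i (refl~ i)))

  rep-≤ : ∀ {i j} → R ∋ i ~ j → toℕ (rep i) ≤ toℕ j
  rep-≤ {i} {j} = proj₂ (proj₂ (least (lookup R i) i (refl~ i))) j

  rep-cong : ∀ {i j} → R ∋ i ~ j → toℕ (rep i) ≡ toℕ (rep j)
  rep-cong {i} {j} p = ≤-antisym (rep-≤ (trans~ i j _ p (rep-~ j))) (rep-≤ (trans~ j i _ (sym~ i j p) (rep-~ i)))

  minimum : ℕ → ℕ
  minimum = extend 0 (toℕ ∘ rep)

  minimum-toℕ : ∀ i → minimum (toℕ i) ≡ toℕ (rep i)
  minimum-toℕ = extend-toℕ 0 (toℕ ∘ rep)

  minimum-canonical : Canonical minimum n
  minimum-canonical j<n with <⇒toℕ j<n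
  ... | i , refl rewrite minimum-toℕ i | minimum-toℕ (rep i) = rep-≤ (refl~ i) , sym (rep-cong (rep-~ i))

  minimum-matrix : matrix n minimum ≡ R
  minimum-matrix = vec-ext λ i → vec-ext λ j → bool-ext
    (λ p → trans~ i (rep i) j (rep-~ i) (sym~ j (rep i)
      (subst (R ∋ j ~_) (toℕ-injective (trans (sym (minimum-toℕ j)) (trans (sym (matrix⁻ minimum i j p)) (minimum-toℕ i)))) (rep-~ j))))
    (λ p → matrix⁺ minimum i j (trans (minimum-toℕ i) (trans (rep-cong p) (sym (minimum-toℕ j)))))

-- The scanning automaton.

-- The block size is q = t + 1.
module Scan (t : ℕ) where

  Label : Set
  Label = ℕ × ℕ

  -- A paused block may be closed, which is the recursive call; a gap may not be dropped while it
  -- lacks elements, so the search ends there. A new block of P₁ already contains `i`, hence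
  -- `push t` and not `push (suc t)`.
  enumResume : ℕ → Stack → List (Label × Stack)
  enumResume i []              = []
  enumResume i (paused b ∷ s)  = ((i , b) , push t i b (paused b ∷ s)) ∷ enumResume i s
  enumResume i (gap r a b ∷ s) = ((i , b) , push t i b (gap r a b ∷ s)) ∷ ((a , b) , push r a b s) ∷ []

  moves : ℕ → Stack → List (Label × Stack)
  moves i s = ((i , i) , push t i i (paused i ∷ s)) ∷ enumResume i s

  prepend : ∀ {k} → (Stack → List (Vec Label k)) → Label × Stack → List (Vec Label (suc k))
  prepend g (x , s) = map (x ∷_) (g s)

  -- At the end every block of P₁ must be complete, while blocks of P₂ may still be open.
  scans : ℕ → Stack → ∀ k → List (Vec Label k)
  scans i s (suc k) = concatMap (prepend (λ s′ → scans (suc i) s′ k)) (moves i s)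
  scans i s zero with missing s
  ... | zero  = [] ∷ []
  ... | suc _ = []

  -- Counting the completions of a stack.

  p : ℕ
  p = 2 * suc t

  total : ∀ {k} → (Stack → List (Vec Label k)) → List (Label × Stack) → ℕ
  total g []             = 0
  total g ((x , s) ∷ ms) = length (g s) + total g ms

  length-prepend : ∀ {k} (g : Stack → List (Vec Label k)) ms → length (concatMap (prepend g) ms) ≡ total g ms
  length-prepend g []             = refl
  length-prepend g ((x , s) ∷ ms) =
    trans (length-++ (map (x ∷_) (g s))) (cong₂ _+_ (length-map _ (g s)) (length-prepend g ms))

  -- A letter fills at most one missing place. The function `g` stands for the scans of the
  -- remaining letters, which separates the analysis of one move from the induction on `k`.
  Dead : ∀ k → (Stack → List (Vec Label k)) → Set
  Dead k g = ∀ s → k < missing s → length (g s) ≡ 0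

  dead-push : ∀ {k} g → Dead k g → ∀ {a b} s → k < missing s → length (g (push t a b s)) ≡ 0
  dead-push g dead s lt = dead _ (≤-trans lt (≤-trans (m≤n+m _ t) (≤-reflexive (sym (missing-push t s)))))

  dead-resume : ∀ {k} g → Dead k g → ∀ i s → suc k < missing s → total g (enumResume i s) ≡ 0
  dead-resume g dead i []              ()
  dead-resume g dead i (paused b ∷ s)  lt =
    cong₂ _+_ (dead-push g dead (paused b ∷ s) (<⇒≤ lt)) (dead-resume g dead i s lt)
  dead-resume g dead i (gap r a b ∷ s) lt =
    cong₂ _+_ (dead-push g dead (gap r a b ∷ s) (<⇒≤ lt))
      (cong (_+ 0) (dead _ (≤-trans (≤-pred lt) (≤-reflexive (sym (missing-push r s))))))

  scans-dead : ∀ k i → Dead k (λ s → scans i s k)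
  scans-dead zero i s lt with missing s | lt
  ... | suc _ | _ = refl
  scans-dead (suc k) i s lt = trans (length-prepend g (moves i s))
    (cong₂ _+_ (dead-push g dead (paused i ∷ s) (<⇒≤ lt)) (dead-resume g dead i s lt))
    where
    g = λ s′ → scans (suc i) s′ k
    dead = scans-dead k (suc i)

  -- The coefficient of zᵐ in z Gʰ.
  next : ℕ → ℕ → ℕ
  next h zero    = 0
  next h (suc m) = raney p h m

  -- The equation G = 1 + z Gᵖ multiplied by Gʰ.
  raney-suc : ∀ h m → raney p (suc h) m ≡ next (h + p) m + raney p h m
  raney-suc h zero    = refl
  raney-suc h (suc m) = +-comm (raney p h (suc m)) _

  -- Here `m` is the number of blocks of P₁ still to be opened: the `k` remaining elements fill
  -- these blocks, `suc t` each, and the gaps.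
  Live : ∀ k → (Stack → List (Vec Label k)) → Set
  Live k g = ∀ m s → k ≡ suc t * m + missing s → length (g s) ≡ raney p (suc (weight s)) m

  -- Opening a block uses up one of the `m`, whence the factor z, and the new exponent is 1 + 2t +
  -- (W + 1) = W + p.
  live-push : ∀ {k} g → Dead k g → Live k g → ∀ m {a b W} s → weight s ≡ suc W →
              suc k ≡ suc t * m + missing s → length (g (push t a b s)) ≡ next (W + p) m
  -- No block remains to be opened, so the `suc k` letters are all needed by the gaps and spending
  -- one elsewhere is fatal.
  live-push {k} g dead live zero s ws eq =
    dead-push g dead s (≤-reflexive (trans eq (cong (_+ missing s) (*-zeroʳ (suc t)))))
  live-push {k} g dead live (suc m) {a} {b} {W} s ws eq =
    trans (live m (push t a b s) eq′) (cong (λ h → raney p h m) weight≡)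
    where
    eq′ : k ≡ suc t * m + missing (push t a b s)
    eq′ = suc-injective (trans eq (trans
      (solve 3 (λ t m u → (con 1 :+ t) :* (con 1 :+ m) :+ u := con 1 :+ ((con 1 :+ t) :* m :+ (t :+ u))) refl t m (missing s))
      (cong (λ u → suc (suc t * m + u)) (sym (missing-push t s)))))
    weight≡ : suc (weight (push t a b s)) ≡ W + p
    weight≡ = trans (cong suc (trans (weight-push t s) (cong (t + t +_) ws)))
      (solve 2 (λ t W → con 1 :+ (t :+ t :+ (con 1 :+ W)) := W :+ con 2 :* (con 1 :+ t)) refl t W)

  -- Declining to open a block of P₂ costs one factor G, leaving exponent `weight s`. Each further
  -- choice splits a power of G by `raney-suc`: the term with z joins a new block of P₁, the other
  -- declines.
  live-resume : ∀ {k} g → Dead k g → Live k g → ∀ i m s → suc k ≡ suc t * m + missing s →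
                total g (enumResume i s) ≡ raney p (weight s) m
  -- This excludes the value `raney p 0 0 ≡ 1`: with nothing missing and nothing to open, no letter
  -- is left to read.
  live-resume g dead live i zero []    eq = contradiction (trans eq (trans (+-identityʳ _) (*-zeroʳ (suc t)))) λ ()
  live-resume g dead live i (suc m) [] eq = refl
  live-resume g dead live i m (paused b ∷ s) eq = trans
    (cong₂ _+_ (live-push g dead live m (paused b ∷ s) refl eq) (live-resume g dead live i m s eq))
    (sym (raney-suc (weight s) m))
  live-resume {k} g dead live i m (gap r a b ∷ s) eq = trans
    (cong₂ _+_ (live-push g dead live m (gap r a b ∷ s) refl eq)
      (trans (+-identityʳ _) (trans (live m (push r a b s) eq′) (cong (λ h → raney p h m) weight≡))))
    (sym (raney-suc (r + suc r + weight s) m))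
    where
    eq′ : k ≡ suc t * m + missing (push r a b s)
    eq′ = trans (suc-injective (trans eq (+-suc (suc t * m) (r + missing s))))
                (cong (suc t * m +_) (sym (missing-push r s)))
    weight≡ : suc (weight (push r a b s)) ≡ r + suc r + weight s
    weight≡ = trans (cong suc (weight-push r s)) (cong (_+ weight s) (sym (+-suc r r)))

  scans-live : ∀ k i → Live k (λ s → scans i s k)
  scans-live zero i m s eq with missing s
  scans-live zero i zero    s eq | zero  = sym (raney-zero p (suc (weight s)))
  scans-live zero i (suc m) s () | zero
  scans-live zero i m       s eq | suc u = contradiction (trans eq (+-suc (suc t * m) u)) λ ()
  scans-live (suc k) i m s eq = trans (length-prepend g (moves i s)) (trans
    (cong₂ _+_ (live-push g dead live m (paused i ∷ s) refl eq) (live-resume g dead live i m s eq))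
    (sym (raney-suc (weight s) m)))
    where
    g = λ s′ → scans (suc i) s′ k
    dead = scans-dead k (suc i)
    live = scans-live k (suc i)

  -- Moves as inductive relations.

  data Resume (i : ℕ) : Stack → ℕ → ℕ → Stack → Set where
    join-paused : ∀ {b s} → Resume i (paused b ∷ s) i b (push t i b (paused b ∷ s))
    close       : ∀ {c s x y s′} → Resume i s x y s′ → Resume i (paused c ∷ s) x y s′
    join-gap    : ∀ {r a b s} → Resume i (gap r a b ∷ s) i b (push t i b (gap r a b ∷ s))
    continue    : ∀ {r a b s} → Resume i (gap r a b ∷ s) a b (push r a b s)

  data Step (i : ℕ) (s : Stack) : ℕ → ℕ → Stack → Set where
    new    : Step i s i i (push t i i (paused i ∷ s))
    resume : ∀ {x y s′} → Resume i s x y s′ → Step i s x y s′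

  ∈resume⇒Resume : ∀ {i x y s′} s → ((x , y) , s′) ∈ enumResume i s → Resume i s x y s′
  ∈resume⇒Resume (paused b ∷ s)  (here refl)         = join-paused
  ∈resume⇒Resume (paused b ∷ s)  (there m)           = close (∈resume⇒Resume s m)
  ∈resume⇒Resume (gap r a b ∷ s) (here refl)         = join-gap
  ∈resume⇒Resume (gap r a b ∷ s) (there (here refl)) = continue

  Resume⇒∈resume : ∀ {i x y s s′} → Resume i s x y s′ → ((x , y) , s′) ∈ enumResume i s
  Resume⇒∈resume join-paused = here refl
  Resume⇒∈resume (close r)   = there (Resume⇒∈resume r)
  Resume⇒∈resume join-gap    = here refl
  Resume⇒∈resume continue    = there (here refl)

  ∈moves⇒Step : ∀ {i x y s s′} → ((x , y) , s′) ∈ moves i s → Step i s x y s′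
  ∈moves⇒Step (here refl) = new
  ∈moves⇒Step (there m)   = resume (∈resume⇒Resume _ m)

  Step⇒∈moves : ∀ {i x y s s′} → Step i s x y s′ → ((x , y) , s′) ∈ moves i s
  Step⇒∈moves new        = here refl
  Step⇒∈moves (resume r) = there (Resume⇒∈resume r)

  -- Well-formed stacks.

  -- Paused labels and gap labels each increase towards the top, so the `b` of a gap is the nearest
  -- paused block beneath it, possibly with other gaps of `b` in between.
  data WF (i : ℕ) : Stack → Set where
    []     : WF i []
    paused : ∀ {b s} → b < i → (∀ {c} → paused c ∈ s → c < b) → WF i s → WF i (paused b ∷ s)
    gap    : ∀ {r a b s} → a < i → (∀ {r′ a′ b′} → gap r′ a′ b′ ∈ s → a′ < a) →
             paused b ∈ s → (∀ {c} → paused c ∈ s → c ≤ b) → WF i s → WF i (gap r a b ∷ s)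

  wf-suc : ∀ {i s} → WF i s → WF (suc i) s
  wf-suc []                    = []
  wf-suc (paused b<i lt w)     = paused (m<n⇒m<1+n b<i) lt (wf-suc w)
  wf-suc (gap a<i lt b∈ le w)  = gap (m<n⇒m<1+n a<i) lt b∈ le (wf-suc w)

  paused-< : ∀ {i s c} → WF i s → paused c ∈ s → c < i
  paused-< (paused b<i _ _)  (here refl) = b<i
  paused-< (paused _ _ w)    (there c∈)  = paused-< w c∈
  paused-< (gap _ _ _ _ w)   (there c∈)  = paused-< w c∈

  gap-< : ∀ {i s r a b} → WF i s → gap r a b ∈ s → a < i
  gap-< (paused _ _ w)    (there g∈)  = gap-< w g∈
  gap-< (gap a<i _ _ _ _) (here refl) = a<i
  gap-< (gap _ _ _ _ w)   (there g∈)  = gap-< w g∈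

  gap-paused : ∀ {i s r a b} → WF i s → gap r a b ∈ s → paused b ∈ s
  gap-paused (paused _ _ w)   (there g∈)  = there (gap-paused w g∈)
  gap-paused (gap _ _ b∈ _ _) (here refl) = there b∈
  gap-paused (gap _ _ _ _ w)  (there g∈)  = there (gap-paused w g∈)

  paused∈push⁺ : ∀ r {a b c s} → paused c ∈ s → paused c ∈ push r a b s
  paused∈push⁺ zero    c∈ = c∈
  paused∈push⁺ (suc r) c∈ = there c∈

  paused∈push⁻ : ∀ r {a b c s} → paused c ∈ push r a b s → paused c ∈ s
  paused∈push⁻ zero    c∈         = c∈
  paused∈push⁻ (suc r) (there c∈) = c∈

  gap∈push⁻ : ∀ r {a b s r′ a′ b′} → gap r′ a′ b′ ∈ push r a b s →
              (a′ ≡ a × b′ ≡ b) ⊎ (∃[ r″ ] gap r″ a′ b′ ∈ s)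
  gap∈push⁻ zero    g∈          = inj₂ (_ , g∈)
  gap∈push⁻ (suc r) (here refl) = inj₁ (refl , refl)
  gap∈push⁻ (suc r) (there g∈)  = inj₂ (_ , g∈)

  wf-push : ∀ r {i a b s} → a < i → (∀ {r′ a′ b′} → gap r′ a′ b′ ∈ s → a′ < a) →
            paused b ∈ s → (∀ {c} → paused c ∈ s → c ≤ b) → WF i s → WF i (push r a b s)
  wf-push zero    a<i lt b∈ le w = w
  wf-push (suc r) a<i lt b∈ le w = gap a<i lt b∈ le w

  head-≤ : ∀ {b s} → (∀ {c} → paused c ∈ s → c < b) → ∀ {c} → paused c ∈ paused b ∷ s → c ≤ b
  head-≤ lt (here refl) = ≤-refl
  head-≤ lt (there c∈)  = <⇒≤ (lt c∈)

  wf-resume : ∀ {i s x y s′} → WF i s → Resume i s x y s′ → WF (suc i) s′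
  wf-resume {i} w@(paused _ lt _) join-paused =
    wf-push t (n<1+n i) (gap-< w) (here refl) (head-≤ lt) (wf-suc w)
  wf-resume (paused _ _ w) (close r) = wf-resume w r
  wf-resume {i} w@(gap _ _ b∈ le _) join-gap =
    wf-push t (n<1+n i) (gap-< w) (there b∈) (λ { (there c∈) → le c∈ }) (wf-suc w)
  wf-resume (gap {r = r} a<i lt b∈ le w) continue = wf-push r (m<n⇒m<1+n a<i) lt b∈ le (wf-suc w)

  wf-step : ∀ {i s x y s′} → WF i s → Step i s x y s′ → WF (suc i) s′
  wf-step w (resume r) = wf-resume w r
  wf-step {i} w new    = wf-push t (n<1+n i) (λ { (there g∈) → gap-< w g∈ }) (here refl)
    (head-≤ (paused-< w)) (paused (n<1+n i) (paused-< w) (wf-suc w))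

  resume-paused : ∀ {i s x y s′} → WF i s → Resume i s x y s′ → paused y ∈ s
  resume-paused w join-paused             = here refl
  resume-paused (paused _ _ w) (close r)  = there (resume-paused w r)
  resume-paused (gap _ _ b∈ _ _) join-gap = there b∈
  resume-paused (gap _ _ b∈ _ _) continue = there b∈

  -- Determinism of the automaton.

  DistinctLabels : List (Label × Stack) → Set
  DistinctLabels = AllPairs (_≢_ on proj₁)

  -- Moves found deeper in the stack have a P₂ label below `b`; the two moves at a gap differ in the
  -- P₁ label since `a < i`.
  resume-distinct : ∀ {i s} → WF i s → DistinctLabels (enumResume i s)
  resume-distinct []            = []
  resume-distinct {i} (paused {b} {s} _ lt w) =
    All.tabulate (λ { {(x , y) , s′} m refl → <-irrefl refl (lt (resume-paused w (∈resume⇒Resume s m))) })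
    ∷ resume-distinct w
  resume-distinct (gap a<i _ _ _ _) = ((λ { refl → <-irrefl refl a<i }) ∷ []) ∷ [] ∷ []

  moves-distinct : ∀ {i s} → WF i s → DistinctLabels (moves i s)
  moves-distinct {i} {s} w =
    All.tabulate (λ { {(x , y) , s′} m refl → <-irrefl refl (paused-< w (resume-paused w (∈resume⇒Resume s m))) })
    ∷ resume-distinct w

  -- Words that begin with different moves differ in their first letter.
  scans-unique : ∀ k {i s} → WF i s → Unique (scans i s k)
  scans-unique zero {s = s} w with missing s
  ... | zero  = [] ∷ []
  ... | suc _ = []
  scans-unique (suc k) {i} {s} w = Unique.concat⁺
    (All.map⁺ (All.tabulate (λ m →
      Unique.map⁺ (λ { refl → refl }) (scans-unique k (wf-step w (∈moves⇒Step m))))))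
    (AllPairs.map⁺ (AllPairs.map
      (λ { x≢y (v∈ , v∈′) → case (∈-map⁻ _ v∈ , ∈-map⁻ _ v∈′) of
           λ { ((_ , _ , refl) , (_ , _ , refl)) → x≢y refl } })
      (moves-distinct w)))

  -- Accepting runs.

  -- The run reads its letters from two functions rather than from a vector, so that invariants can
  -- also speak of the letters before `i`.
  data Path (f g : ℕ → ℕ) : ℕ → Stack → ℕ → Set where
    done : ∀ {i s} → missing s ≡ 0 → Path f g i s 0
    step : ∀ {i s s′ k} → Step i s (f i) (g i) s′ → Path f g (suc i) s′ k → Path f g i s (suc k)

  labels : (f g : ℕ → ℕ) → ℕ → ∀ k → Vec Label k
  labels f g i zero    = []
  labels f g i (suc k) = (f i , g i) ∷ labels f g (suc i) k

  ∈scans⇒Path : ∀ {f g} k {i s} → labels f g i k ∈ scans i s k → Path f g i s k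
  ∈scans⇒Path zero {i} {s} v∈ with missing s in eq
  ... | zero = done eq
  ∈scans⇒Path (suc k) {i} {s} v∈ with find (∈-concatMap⁻ (prepend (λ s′ → scans (suc i) s′ k)) {xs = moves i s} v∈)
  ... | ((x , y) , s′) , m , v∈′ with ∈-map⁻ _ v∈′
  ...   | w , w∈ , eq with ∷-injective eq
  ...     | refl , refl = step (∈moves⇒Step m) (∈scans⇒Path k w∈)

  Path⇒∈scans : ∀ {f g k i s} → Path f g i s k → labels f g i k ∈ scans i s k
  Path⇒∈scans {s = s} (done eq) with missing s | eq
  ... | zero | _ = here refl
  Path⇒∈scans {k = suc k} {i} {s} (step st π) =
    ∈-concatMap⁺ (prepend (λ s′ → scans (suc i) s′ k)) (lose (Step⇒∈moves st) (∈-map⁺ _ (Path⇒∈scans π)))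

  -- The effect of a move on the stack.

  step-paused : ∀ {i s x y s′} → WF i s → Step i s x y s′ → y ≡ i ⊎ paused y ∈ s
  step-paused w new        = inj₁ refl
  step-paused w (resume r) = inj₂ (resume-paused w r)

  resume-paused⁺ : ∀ {i s x y s′} → WF i s → Resume i s x y s′ → ∀ {c} → paused c ∈ s → c ≤ y → paused c ∈ s′
  resume-paused⁺ w join-paused c∈ c≤y = paused∈push⁺ t c∈
  resume-paused⁺ (paused _ lt w) (close r) (here refl) c≤y =
    contradiction c≤y (<⇒≱ (lt (resume-paused w r)))
  resume-paused⁺ (paused _ _ w) (close r) (there c∈) c≤y = resume-paused⁺ w r c∈ c≤y
  resume-paused⁺ w join-gap c∈ c≤y = paused∈push⁺ t c∈
  resume-paused⁺ w (continue {r = r}) (there c∈) c≤y = paused∈push⁺ r c∈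

  resume-paused⁻ : ∀ {i s x y s′} → WF i s → Resume i s x y s′ → ∀ {c} → paused c ∈ s′ → paused c ∈ s × c ≤ y
  resume-paused⁻ (paused _ lt _) join-paused c∈ = paused∈push⁻ t c∈ , head-≤ lt (paused∈push⁻ t c∈)
  resume-paused⁻ (paused _ _ w) (close r) c∈ with resume-paused⁻ w r c∈
  ... | c∈s , c≤y = there c∈s , c≤y
  resume-paused⁻ (gap _ _ _ le _) join-gap c∈ with paused∈push⁻ t c∈
  ... | there c∈s = there c∈s , le c∈s
  resume-paused⁻ (gap _ _ _ le _) (continue {r = r}) c∈ = there (paused∈push⁻ r c∈) , le (paused∈push⁻ r c∈)

  -- With `step-paused⁻`, this says that a move closes exactly the blocks of P₂ above `y`.
  step-paused⁺ : ∀ {i s x y s′} → WF i s → Step i s x y s′ → ∀ {c} → c ≡ y ⊎ (paused c ∈ s × c < y) → paused c ∈ s′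
  step-paused⁺ w new        (inj₁ refl)       = paused∈push⁺ t (here refl)
  step-paused⁺ w new        (inj₂ (c∈ , _))   = paused∈push⁺ t (there c∈)
  step-paused⁺ w (resume r) (inj₁ refl)       = resume-paused⁺ w r (resume-paused w r) ≤-refl
  step-paused⁺ w (resume r) (inj₂ (c∈ , c<y)) = resume-paused⁺ w r c∈ (<⇒≤ c<y)

  step-paused⁻ : ∀ {i s x y s′} → WF i s → Step i s x y s′ → ∀ {c} → paused c ∈ s′ → c ≡ y ⊎ (paused c ∈ s × c < y)
  step-paused⁻ w new c∈ with paused∈push⁻ t c∈
  ... | here refl = inj₁ refl
  ... | there c∈s = inj₂ (c∈s , paused-< w c∈s)
  step-paused⁻ w (resume r) c∈ with resume-paused⁻ w r c∈
  ... | c∈s , c≤y with m≤n⇒m<n∨m≡n c≤y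
  ...   | inj₁ c<y = inj₂ (c∈s , c<y)
  ...   | inj₂ c≡y = inj₁ c≡y

  resume-gap⁻ : ∀ {i s x y s′} → WF i s → Resume i s x y s′ → ∀ {r a b} → gap r a b ∈ s′ →
                (a ≡ x × b ≡ y) ⊎ ((∃[ r′ ] gap r′ a b ∈ s) × a < x)
  resume-gap⁻ w join-paused g∈ with gap∈push⁻ t g∈
  ... | inj₁ eqs       = inj₁ eqs
  ... | inj₂ (r , g∈s) = inj₂ ((r , g∈s) , gap-< w g∈s)
  resume-gap⁻ (paused _ _ w) (close r) g∈ with resume-gap⁻ w r g∈
  ... | inj₁ eqs               = inj₁ eqs
  ... | inj₂ ((r , g∈s) , a<x) = inj₂ ((r , there g∈s) , a<x)
  resume-gap⁻ w join-gap g∈ with gap∈push⁻ t g∈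
  ... | inj₁ eqs       = inj₁ eqs
  ... | inj₂ (r , g∈s) = inj₂ ((r , g∈s) , gap-< w g∈s)
  resume-gap⁻ (gap _ lt _ _ _) (continue {r = r}) g∈ with gap∈push⁻ r g∈
  ... | inj₁ eqs       = inj₁ eqs
  ... | inj₂ (r , g∈s) = inj₂ ((r , there g∈s) , lt g∈s)

  step-gap⁻ : ∀ {i s x y s′} → WF i s → Step i s x y s′ → ∀ {r a b} → gap r a b ∈ s′ →
              (a ≡ x × b ≡ y) ⊎ ((∃[ r′ ] gap r′ a b ∈ s) × a < x)
  step-gap⁻ w (resume r) g∈ = resume-gap⁻ w r g∈
  step-gap⁻ w new g∈ with gap∈push⁻ t g∈
  ... | inj₁ eqs             = inj₁ eqs
  ... | inj₂ (r , there g∈s) = inj₂ ((r , g∈s) , gap-< w g∈s)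

  Opens : ℕ → Stack → ℕ → Stack → Set
  Opens i s x s′ = x ≡ i × (∀ z → lacking s′ z ≡ t * indicator i z + lacking s z)

  Continues : Stack → ℕ → ℕ → Stack → Set
  Continues s x y s′ = (∃[ r ] gap r x y ∈ s) × (∀ z → indicator x z + lacking s′ z ≡ lacking s z)

  resume-lacking : ∀ {i s x y s′} → Resume i s x y s′ → Opens i s x s′ ⊎ Continues s x y s′
  resume-lacking (join-paused {s = s}) = inj₁ (refl , lacking-push t (paused _ ∷ s))
  resume-lacking (join-gap {s = s})    = inj₁ (refl , lacking-push t (gap _ _ _ ∷ s))
  resume-lacking (close r) with resume-lacking r
  ... | inj₁ o                = inj₁ o
  ... | inj₂ ((r′ , g∈) , eq) = inj₂ ((r′ , there g∈) , eq)
  resume-lacking (continue {r} {a} {b} {s}) = inj₂ ((r , here refl) , λ z →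
    trans (cong (indicator a z +_) (lacking-push r s z)) (sym (+-assoc (indicator a z) _ _)))

  step-lacking : ∀ {i s x y s′} → Step i s x y s′ → Opens i s x s′ ⊎ Continues s x y s′
  step-lacking {s = s} new = inj₁ (refl , lacking-push t (paused _ ∷ s))
  step-lacking (resume r)  = resume-lacking r

  lacking-fresh : ∀ {i s} → WF i s → lacking s i ≡ 0
  lacking-fresh {i} {s} w with lacking s i in eq
  ... | zero  = refl
  ... | suc _ with lacking⇒gap s (≤-trans (s≤s z≤n) (≤-reflexive (sym eq)))
  ...   | r , b , g∈ = contradiction (gap-< w g∈) (<-irrefl refl)

  -- Soundness of the automaton.

  -- The conditions on the pair in terms of block minima: for `refines` each element is compared
  -- with the minimum of its block of P₁, and `sizes` tests each block at its minimum.
  record Good (f g : ℕ → ℕ) (n : ℕ) : Set where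
    field
      canonical₁   : Canonical f n
      canonical₂   : Canonical g n
      refines      : ∀ {j} → j < n → g (f j) ≡ g j
      noncrossing₁ : NonCrossing f n
      noncrossing₂ : NonCrossing g n
      sizes        : ∀ {a} → a < n → f a ≡ a → count f a n ≡ suc t

  -- `Good` for the prefix read so far, with sizes corrected by what is lacking. The paused frames
  -- are exactly the visible blocks of P₂; the converse `⇒paused` serves completeness.
  record Inv (f g : ℕ → ℕ) (i : ℕ) (s : Stack) : Set where
    field
      wf           : WF i s
      canonical₁   : Canonical f i
      canonical₂   : Canonical g i
      refines      : ∀ {j} → j < i → g (f j) ≡ g j
      noncrossing₁ : NonCrossing f i
      noncrossing₂ : NonCrossing g i
      sizes        : ∀ {a} → a < i → f a ≡ a → count f a i + lacking s a ≡ suc t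
      gap⇒         : ∀ {r a b} → gap r a b ∈ s → f a ≡ a × g a ≡ b × Visible f i a
      paused⇒      : ∀ {c} → paused c ∈ s → g c ≡ c × Visible g i c
      ⇒paused      : ∀ {c} → c < i → g c ≡ c → Visible g i c → paused c ∈ s

  inv-start : ∀ {f g} → Inv f g 0 []
  inv-start = record
    { wf = [] ; canonical₁ = λ () ; canonical₂ = λ () ; refines = λ ()
    ; noncrossing₁ = λ _ _ _ () ; noncrossing₂ = λ _ _ _ () ; sizes = λ ()
    ; gap⇒ = λ () ; paused⇒ = λ () ; ⇒paused = λ () }

  inv-step : ∀ {f g i s s′} → Inv f g i s → Step i s (f i) (g i) s′ → Inv f g (suc i) s′
  inv-step {f} {g} {i} {s} {s′} inv st = record
    { wf           = wf-step wf st
    ; canonical₁   = can₁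
    ; canonical₂   = can₂
    ; refines      = refines′
    ; noncrossing₁ = noncrossing-suc noncrossing₁ vis₁
    ; noncrossing₂ = noncrossing-suc noncrossing₂ vis₂
    ; sizes        = sizes′
    ; gap⇒         = gap⇒′
    ; paused⇒      = paused⇒′
    ; ⇒paused      = ⇒paused′
    }
    where
    open Inv inv
    first : f i ≡ i ⊎ (f i < i × f (f i) ≡ f i × g (f i) ≡ g i × Visible f i (f i))
    first with step-lacking st
    ... | inj₁ (fi≡i , _)     = inj₁ fi≡i
    ... | inj₂ ((_ , g∈) , _) = inj₂ (gap-< wf g∈ , gap⇒ g∈)
    second : g i ≡ i ⊎ (g i < i × g (g i) ≡ g i × Visible g i (g i))
    second with step-paused wf st
    ... | inj₁ gi≡i = inj₁ gi≡i
    ... | inj₂ c∈   = inj₂ (paused-< wf c∈ , paused⇒ c∈)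
    can₁ : Canonical f (suc i)
    can₁ = canonical-suc canonical₁ (map₂ (λ (lt , eq , _) → lt , eq) first)
    can₂ : Canonical g (suc i)
    can₂ = canonical-suc canonical₂ (map₂ (λ (lt , eq , _) → lt , eq) second)
    vis₁ : Visible f i (f i)
    vis₁ with first
    ... | inj₁ fi≡i             = subst (Visible f i) (sym fi≡i) (visible-fresh canonical₁)
    ... | inj₂ (_ , _ , _ , vis) = vis
    vis₂ : Visible g i (g i)
    vis₂ with second
    ... | inj₁ gi≡i         = subst (Visible g i) (sym gi≡i) (visible-fresh canonical₂)
    ... | inj₂ (_ , _ , vis) = vis
    refines′ : ∀ {j} → j < suc i → g (f j) ≡ g j
    refines′ j<1+i with m<1+n⇒m<n∨m≡n j<1+i | first
    ... | inj₁ j<i  | _                     = refines j<i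
    ... | inj₂ refl | inj₁ fi≡i             = cong g fi≡i
    ... | inj₂ refl | inj₂ (_ , _ , eq , _) = eq
    sizes′ : ∀ {a} → a < suc i → f a ≡ a → count f a (suc i) + lacking s′ a ≡ suc t
    sizes′ {a} a<1+i fa≡a with m<1+n⇒m<n∨m≡n a<1+i | step-lacking st
    ... | inj₁ a<i  | inj₁ (fi≡i , lk) = trans
      (cong₂ (λ u v → u + count f a i + v) ind≡0
        (trans (lk a) (cong (_+ lacking s a) (trans (cong (t *_) (indicator-≢ (<⇒≢ a<i ∘ sym))) (*-zeroʳ t)))))
      (sizes a<i fa≡a)
      where
      ind≡0 : indicator (f i) a ≡ 0
      ind≡0 = indicator-≢ (λ fi≡a → <⇒≢ a<i (trans (sym fi≡a) fi≡i))
    ... | inj₁ a<i  | inj₂ (_ , lk) = trans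
      (trans (cong (_+ lacking s′ a) (+-comm (indicator (f i) a) (count f a i)))
        (trans (+-assoc (count f a i) _ _) (cong (count f a i +_) (lk a))))
      (sizes a<i fa≡a)
    -- A block just opened has `count` 1 + 0 and lacks t + 0 elements, since no earlier label and no
    -- gap of `s` is `i`.
    ... | inj₂ refl | inj₁ (fi≡i , lk) = cong₂ _+_
      (cong₂ _+_ (trans (cong (λ u → indicator u i) fi≡i) (indicator-refl i))
        (count-fresh f i (λ j<i fj≡i → <⇒≱ j<i (≤-trans (≤-reflexive (sym fj≡i)) (proj₁ (canonical₁ j<i))))))
      (trans (lk i) (trans (cong₂ (λ u v → t * u + v) (indicator-refl i) (lacking-fresh wf))
        (trans (+-identityʳ _) (*-identityʳ t))))
    ... | inj₂ refl | inj₂ ((_ , g∈) , _) = contradiction (gap-< wf g∈) (<-irrefl fa≡a)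
    gap⇒′ : ∀ {r a b} → gap r a b ∈ s′ → f a ≡ a × g a ≡ b × Visible f (suc i) a
    gap⇒′ g∈ with step-gap⁻ wf st g∈
    ... | inj₁ (refl , refl) = proj₂ (can₁ ≤-refl) , refines′ ≤-refl , visible-self vis₁
    ... | inj₂ ((_ , g∈s) , a<fi) with gap⇒ g∈s
    ...   | fa≡a , ga≡b , vis = fa≡a , ga≡b , visible-below can₁ vis₁ vis fa≡a a<fi
    paused⇒′ : ∀ {c} → paused c ∈ s′ → g c ≡ c × Visible g (suc i) c
    paused⇒′ c∈ with step-paused⁻ wf st c∈
    ... | inj₁ refl = proj₂ (can₂ ≤-refl) , visible-self vis₂
    ... | inj₂ (c∈s , c<gi) with paused⇒ c∈s
    ...   | gc≡c , vis = gc≡c , visible-below can₂ vis₂ vis gc≡c c<gi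
    ⇒paused′ : ∀ {c} → c < suc i → g c ≡ c → Visible g (suc i) c → paused c ∈ s′
    ⇒paused′ {c} c<1+i gc≡c vis with m<1+n⇒m<n∨m≡n c<1+i
    ... | inj₂ refl = step-paused⁺ wf st (inj₁ (sym gc≡c))
    -- Blocks above `g i` are hidden by the arc from `g i` to `i`, so a visible `c` is at most `g i`
    -- and survives the move.
    ... | inj₁ c<i with <-cmp c (g i)
    ...   | tri< c<gi _ _ = step-paused⁺ wf st (inj₂ (⇒paused c<i gc≡c (visible-pred vis) , c<gi))
    ...   | tri≈ _ c≡gi _ = step-paused⁺ wf st (inj₁ c≡gi)
    ...   | tri> _ _ gi<c = ⊥-elim (visible-above can₂ c<i gc≡c gi<c vis)

  path⇒inv : ∀ {f g i s k} → Path f g i s k → Inv f g i s → ∃[ s′ ] (missing s′ ≡ 0 × Inv f g (i + k) s′)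
  path⇒inv {f} {g} {i} {s} (done eq) inv = s , eq , subst (λ n → Inv f g n s) (sym (+-identityʳ i)) inv
  path⇒inv {f} {g} {i} {k = suc k} (step st π) inv with path⇒inv π (inv-step inv st)
  ... | s′ , eq , inv′ = s′ , eq , subst (λ n → Inv f g n s′) (sym (+-suc i k)) inv′

  path⇒good : ∀ {f g n} → Path f g 0 [] n → Good f g n
  path⇒good {f} {g} {n} π with path⇒inv π inv-start
  ... | s , eq , inv = record
    { canonical₁ = canonical₁ ; canonical₂ = canonical₂ ; refines = refines
    ; noncrossing₁ = noncrossing₁ ; noncrossing₂ = noncrossing₂
    ; sizes = λ {a} a<n fa≡a → trans
        (trans (sym (+-identityʳ _)) (cong (count f a n +_) (sym (missing≡0⇒lacking≡0 s eq a))))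
        (sizes a<n fa≡a) }
    where open Inv inv

  -- Completeness of the automaton.

  -- Paused frames above `y` are closed one by one. A gap met on the way has `y ≤ b`, so `ok` forces
  -- `b ≡ y` and the new block nests inside that gap.
  find-join : ∀ {i y s} → WF i s → (∀ {r a b} → gap r a b ∈ s → ¬ y < b) → paused y ∈ s → ∃[ s′ ] Resume i s i y s′
  find-join {y = y} (paused {b} _ _ w) ok y∈ with b ≟ y
  ... | yes refl = _ , join-paused
  find-join (paused _ _ w) ok (here refl) | no b≢y = contradiction refl b≢y
  find-join (paused _ _ w) ok (there y∈)  | no b≢y with find-join w (ok ∘ there) y∈
  ... | s′ , r = s′ , close r
  find-join {y = y} (gap {b = b} _ _ _ le _) ok (there y∈) with b ≟ y
  ... | yes refl = _ , join-gap
  ... | no  b≢y  = contradiction (≤∧≢⇒< (le y∈) (b≢y ∘ sym)) (ok (here refl))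

  find-continue : ∀ {i r a b s} → WF i s → (∀ {r′ a′ b′} → gap r′ a′ b′ ∈ s → ¬ a < a′) → gap r a b ∈ s →
                  ∃[ s′ ] Resume i s a b s′
  find-continue (paused _ _ w) ok (there g∈) with find-continue w (ok ∘ there) g∈
  ... | s′ , r = s′ , close r
  find-continue w                ok (here refl) = _ , continue
  find-continue (gap _ lt _ _ _) ok (there g∈)  = contradiction (lt g∈) (ok (here refl))

  -- An incomplete block has fewer than `suc t` elements before `i` but exactly `suc t` in the end.
  gap-future : ∀ {f g n i s} → Good f g n → Inv f g i s → i ≤ n → ∀ {r a b} → gap r a b ∈ s →
               ∃[ d ] (i ≤ d × d < n × f d ≡ a)
  gap-future {f} {n = n} {i} {s} good inv i≤n {a = a} g∈ = count-find f a i n (begin-strict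
    count f a i               <⟨ m<m+n _ (lacking-gap g∈) ⟩
    count f a i + lacking s a ≡⟨ Inv.sizes inv a<i fa≡a ⟩
    suc t                     ≡⟨ Good.sizes good (<-≤-trans a<i i≤n) fa≡a ⟨
    count f a n               ∎)
    where
    open ≤-Reasoning
    a<i = gap-< (Inv.wf inv) g∈
    fa≡a = proj₁ (Inv.gap⇒ inv g∈)

  -- The frame to be joined or continued is on the stack: `g i` by visibility, the gap of `f i` by
  -- size. A gap that blocked the way would have a later element by `gap-future`, giving a crossing.
  good-step : ∀ {f g n i s} → Good f g n → Inv f g i s → i < n → ∃[ s′ ] Step i s (f i) (g i) s′
  good-step {f} {g} {n} {i} {s} good inv i<n with f i ≟ i | g i ≟ i
  ... | yes fi≡i | yes gi≡i = _ , subst₂ (λ x y → Step i s x y (push t i i (paused i ∷ s))) (sym fi≡i) (sym gi≡i) new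
  ... | yes fi≡i | no  gi≢i = map-proof (λ {s′} r → resume (subst (λ x → Resume i s x (g i) s′) (sym fi≡i) r))
    (find-join wf blocked (⇒paused gi<i ggi≡gi (noncrossing-visible (Good.noncrossing₂ good) i<n)))
    where
    open Inv inv
    gi<i = ≤∧≢⇒< (proj₁ (Good.canonical₂ good i<n)) gi≢i
    ggi≡gi = proj₂ (Good.canonical₂ good i<n)
    -- The crossing is `g i < b < i < d` in P₂, where `d` is a later element of the block `a` inside
    -- `b`.
    blocked : ∀ {r a b} → gap r a b ∈ s → ¬ g i < b
    blocked {a = a} {b} g∈ gi<b with gap-future good inv (<⇒≤ i<n) g∈ | gap⇒ g∈ | paused⇒ (gap-paused wf g∈)
    ... | d , i≤d , d<n , fd≡a | fa≡a , ga≡b , _ | gb≡b , _ = <⇒≢ gi<b (trans (sym ggi≡gi) (trans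
      (Good.noncrossing₂ good gi<b (paused-< wf (gap-paused wf g∈)) i<d d<n ggi≡gi gb≡gd) gb≡b))
      where
      i<d : i < d
      i<d = ≤∧≢⇒< i≤d λ { refl → <-irrefl (trans (sym fd≡a) fi≡i) (gap-< wf g∈) }
      gb≡gd : g b ≡ g d
      gb≡gd = trans gb≡b (trans (sym ga≡b) (trans (cong g (sym fd≡a)) (Good.refines good d<n)))
  ... | no  fi≢i | _ with lacking⇒gap s (lacked (lacking s (f i)) refl)
    where
    open Inv inv
    fi<i = ≤∧≢⇒< (proj₁ (Good.canonical₁ good i<n)) fi≢i
    ffi≡fi = proj₂ (Good.canonical₁ good i<n)
    lacked : ∀ u → lacking s (f i) ≡ u → 0 < lacking s (f i)
    lacked (suc u) eq = subst (0 <_) (sym eq) (s≤s z≤n)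
    -- If the block `f i` were already full, the element `i` would make it too large.
    lacked zero    eq = contradiction refl (<⇒≢ (begin-strict
      suc t                                 ≡⟨ sizes fi<i ffi≡fi ⟨
      count f (f i) i + lacking s (f i)     ≡⟨ cong (count f (f i) i +_) eq ⟩
      count f (f i) i + 0                   ≡⟨ +-identityʳ _ ⟩
      count f (f i) i                       <⟨ n<1+n _ ⟩
      1 + count f (f i) i                   ≡⟨ cong (_+ count f (f i) i) (indicator-refl (f i)) ⟨
      count f (f i) (suc i)                 ≤⟨ count-mono f (f i) i<n ⟩
      count f (f i) n                       ≡⟨ Good.sizes good (<-trans fi<i i<n) ffi≡fi ⟩
      suc t                                 ∎))
      where open ≤-Reasoning
  ...   | r , b , g∈ = map-proof (λ {s′} r → resume (subst (λ y → Resume i s (f i) y s′) b≡gi r))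
    (find-continue wf blocked g∈)
    where
    open Inv inv
    b≡gi : b ≡ g i
    b≡gi = trans (sym (proj₁ (proj₂ (gap⇒ g∈)))) (Good.refines good i<n)
    -- The crossing is `f i < a < i < d` in P₁.
    blocked : ∀ {r a b} → gap r a b ∈ s → ¬ f i < a
    blocked {a = a} g∈′ fi<a with gap-future good inv (<⇒≤ i<n) g∈′ | gap⇒ g∈′
    ... | d , i≤d , d<n , fd≡a | fa≡a , _ = <⇒≢ fi<a (trans (sym ffi≡fi) (trans
      (Good.noncrossing₁ good fi<a (gap-< wf g∈′) i<d d<n ffi≡fi (trans fa≡a (sym fd≡a))) fa≡a))
      where
      ffi≡fi = proj₂ (Good.canonical₁ good i<n)
      i<d : i < d
      i<d = ≤∧≢⇒< i≤d λ { refl → <⇒≢ fi<a fd≡a }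

  good⇒path : ∀ {f g} k {n i s} → Good f g n → Inv f g i s → i + k ≡ n → Path f g i s k
  -- A gap left at the end would require an element `d` with `n ≤ d < n`.
  good⇒path zero {i = i} {s} good inv refl = done (no-gap⇒missing≡0 s λ g∈ →
    case gap-future good inv (≤-reflexive (sym (+-identityʳ i))) g∈ of
      λ (d , i≤d , d<n , _) → <⇒≱ d<n (≤-trans (≤-reflexive (+-identityʳ i)) i≤d))
  good⇒path (suc k) {i = i} good inv refl with good-step good inv (m<m+n i (s≤s z≤n))
  ... | s′ , st = step st (good⇒path k good (inv-step inv st) (sym (+-suc i k)))

  -- From labellings to pairs of partitions.

  PlanarPair : ∀ {n} → Rel[ n ] → Rel[ n ] → Set
  PlanarPair P₁ P₂ = IsPlanarPartition P₁ × IsPlanarPartition P₂ × Refines P₁ P₂ × IsQPartition (suc t) P₁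

  good⇒planarPair : ∀ {n f g} → Good f g n → PlanarPair (matrix n f) (matrix n g)
  good⇒planarPair {n} {f} {g} good =
    (matrix-partition f , noncrossing⇒planar f noncrossing₁)
    , (matrix-partition g , noncrossing⇒planar g noncrossing₂)
    , (λ i j p → matrix⁺ g i j (trans (sym (refines (toℕ<n i))) (trans (cong g (matrix⁻ f i j p)) (refines (toℕ<n j)))))
    , matrix-partition f
    , (λ i → let fi≤i , ffi≡fi = canonical₁ (toℕ<n i) in
        trans (blockSize-matrix f i) (sizes (≤-<-trans fi≤i (toℕ<n i)) ffi≡fi))
    where open Good good

  planarPair⇒good : ∀ {n f g} → Canonical f n → Canonical g n → PlanarPair (matrix n f) (matrix n g) → Good f g n
  planarPair⇒good {n} {f} {g} can₁ can₂ ((_ , pl₁) , (_ , pl₂) , ref , (_ , size)) = record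
    { canonical₁   = can₁
    ; canonical₂   = can₂
    ; refines      = λ j<n → refines⇒ f g ref (≤-<-trans (proj₁ (can₁ j<n)) j<n) j<n (proj₂ (can₁ j<n))
    ; noncrossing₁ = planar⇒noncrossing f pl₁
    ; noncrossing₂ = planar⇒noncrossing g pl₂
    ; sizes        = sizes
    }
    where
    sizes : ∀ {a} → a < n → f a ≡ a → count f a n ≡ suc t
    sizes a<n fa≡a with <⇒toℕ a<n
    ... | i , refl = trans (cong (λ u → count f u n) (sym fa≡a)) (trans (sym (blockSize-matrix f i)) (size i))

  at : ∀ {k} → Vec Label k → ℕ → Label
  at v = extend (0 , 0) (lookup v)

  first second : ∀ {k} → Vec Label k → ℕ → ℕ
  first v  = proj₁ ∘ at v
  second v = proj₂ ∘ at v

  labels-suc : ∀ f g i k → labels f g (suc i) k ≡ labels (f ∘ suc) (g ∘ suc) i k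
  labels-suc f g i zero    = refl
  labels-suc f g i (suc k) = cong (_ ∷_) (labels-suc f g (suc i) k)

  labels-at : ∀ {k} (v : Vec Label k) → labels (first v) (second v) 0 k ≡ v
  labels-at []      = refl
  labels-at (x ∷ v) = cong (x ∷_) (trans (labels-suc (first (x ∷ v)) (second (x ∷ v)) 0 _) (labels-at v))

  lookup-labels : ∀ f g {k} (j : Fin k) → lookup (labels f g 0 k) j ≡ (f (toℕ j) , g (toℕ j))
  lookup-labels f g zero            = refl
  lookup-labels f g {suc k} (suc j) = trans (cong (λ v → lookup v j) (labels-suc f g 0 k)) (lookup-labels (f ∘ suc) (g ∘ suc) j)

  at-labels : ∀ f g {k} (j : Fin k) → at (labels f g 0 k) (toℕ j) ≡ (f (toℕ j) , g (toℕ j))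
  at-labels f g {k} j = trans (extend-toℕ _ (lookup (labels f g 0 k)) j) (lookup-labels f g j)

  ∈scans⇒good : ∀ {n} {v : Vec Label n} → v ∈ scans 0 [] n → Good (first v) (second v) n
  ∈scans⇒good {n} {v} v∈ = path⇒good (∈scans⇒Path n (subst (_∈ scans 0 [] n) (sym (labels-at v)) v∈))

  partitions : ∀ {n} → Vec Label n → Rel[ n ] × Rel[ n ]
  partitions {n} v = matrix n (first v) , matrix n (second v)

  -- Labels in an accepted word are block minima, which the relations determine.
  partitions-injective : ∀ {n} {v w : Vec Label n} → v ∈ scans 0 [] n → w ∈ scans 0 [] n →
                         partitions v ≡ partitions w → v ≡ w
  partitions-injective {n} {v} {w} v∈ w∈ eq = vec-ext λ i →
    trans (sym (extend-toℕ _ (lookup v) i)) (trans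
      (cong₂ _,_
        (canonical-unique (first v) (first w) (Good.canonical₁ good₁) (Good.canonical₁ good₂) (cong proj₁ eq) (toℕ<n i))
        (canonical-unique (second v) (second w) (Good.canonical₂ good₁) (Good.canonical₂ good₂) (cong proj₂ eq) (toℕ<n i)))
      (extend-toℕ _ (lookup w) i))
    where
    good₁ = ∈scans⇒good v∈
    good₂ = ∈scans⇒good w∈

  pairs : ∀ n → List (Rel[ n ] × Rel[ n ])
  pairs n = map partitions (scans 0 [] n)

  pairs-unique : ∀ n → Unique (pairs n)
  pairs-unique n = unique-map-on partitions-injective (scans-unique n [])

  ∈pairs⇒planarPair : ∀ {n P₁ P₂} → (P₁ , P₂) ∈ pairs n → PlanarPair P₁ P₂
  ∈pairs⇒planarPair {n} P∈ with ∈-map⁻ partitions P∈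
  ... | v , v∈ , refl = good⇒planarPair (∈scans⇒good v∈)

  planarPair⇒∈pairs : ∀ {n P₁ P₂} → PlanarPair P₁ P₂ → (P₁ , P₂) ∈ pairs n
  planarPair⇒∈pairs {n} {P₁} {P₂} pp@((part₁ , _) , (part₂ , _) , _) =
    subst (_∈ pairs n) partitions≡ (∈-map⁺ partitions (Path⇒∈scans (good⇒path n good inv-start refl)))
    where
    module R₁ = Representatives part₁
    module R₂ = Representatives part₂
    good : Good R₁.minimum R₂.minimum n
    good = planarPair⇒good R₁.minimum-canonical R₂.minimum-canonical
      (subst₂ PlanarPair (sym R₁.minimum-matrix) (sym R₂.minimum-matrix) pp)
    ls = labels R₁.minimum R₂.minimum 0 n
    partitions≡ : partitions ls ≡ (P₁ , P₂)
    partitions≡ = cong₂ _,_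
      (trans (matrix-cong (first ls) R₁.minimum (cong proj₁ ∘ at-labels R₁.minimum R₂.minimum)) R₁.minimum-matrix)
      (trans (matrix-cong (second ls) R₂.minimum (cong proj₂ ∘ at-labels R₁.minimum R₂.minimum)) R₂.minimum-matrix)

  -- The empty stack has weight 0 and all `n` blocks are unopened, so the count is the coefficient
  -- of zⁿ in G.
  length-pairs : ∀ n → length (pairs (suc t * n)) ≡ raney p 1 n
  length-pairs n = trans (length-map partitions (scans 0 [] (suc t * n)))
    (scans-live (suc t * n) 0 n [] (sym (+-identityʳ _)))

-- The Fuss-Catalan number.

raney-1 : ∀ t n → let p = suc t in raney p 1 n ≡ (suc (p * n) C n) / suc (p * n)
raney-1 t n = trans (sym (m*n/n≡m (raney p 1 n) (suc (p * n)))) (cong (_/ suc (p * n)) eq)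
  where
  p = suc t
  eq : raney p 1 n * suc (p * n) ≡ suc (p * n) C n
  eq = subst (λ u → raney p 1 n * u ≡ u C n) (+-comm (p * n) 1)
    (trans (raney-binomial t 1 n) (*-identityˡ ((p * n + 1) C n)))

theorem2 : (q n : ℕ) → 1 ≤ q → 1 ≤ n →
    Σ (List (Rel[ q * n ] × Rel[ q * n ])) (λ L →
    Unique L
    × (∀ (P₁ P₂ : Rel[ q * n ]) →
    ((P₁ , P₂) ∈ L) ⇔
    (IsPlanarPartition P₁ × IsPlanarPartition P₂
    × Refines P₁ P₂ × IsQPartition q P₁))
    × length L ≡ (suc ((2 * q) * n) C n) / suc ((2 * q) * n))
theorem2 (suc t) n _ _ =
  pairs (suc t * n)
  , pairs-unique (suc t * n)
  , (λ P₁ P₂ → mk⇔ ∈pairs⇒planarPair planarPair⇒∈pairs)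
  -- `raney-1` expects the predecessor of p, and `2 * suc t` computes to `suc (t + (suc t + 0))`.
  , trans (length-pairs n) (raney-1 (t + (suc t + 0)) n)
  where open Scan t
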